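{- The exponential generating function $\mathsf{L}(t)=\sum_{n=0}^\infty \mathcal{L}_n\frac{t^n}{n!}$ of the Lucas-Fubini numbers is given by $$\mathsf{L}(t)= \alpha e^{\left(e^{t}-1\right)\alpha}+\beta e^{\left(e^{t}-1\right)\beta}.$$
   Context: $\alpha=(1+\sqrt5)/2$ and $\beta=(1-\sqrt5)/2$. The identity is one of formal power series in $t$. ${n\brace k}$ denotes the Stirling number of the second kind (the number of partitions of an $n$-element set into exactly $k$ non-empty blocks). $L_m$ denotes the Lucas numbers: $L_0=2$, $L_1=1$, $L_m=L_{m-1}+L_{m-2}$ for $m\ge2$. The Lucas-Fubini numbers are defined by $\mathcal{L}_n=\sum_{k=0}^n L_{k+1}{n\brace k}$ for $n\ge0$. -}

module Defs where

open import Data.Nat.Base as ℕ using (ℕ; zero; suc; _∸_; _!)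
open import Data.Nat.Properties using (_!≢0)
import Data.Nat.Properties as ℕ
open import Data.Nat.ListAction using (sum)
open import Data.Integer.Base using (+_)
open import Data.Rational.Base as ℚ using (ℚ; 0ℚ; 1ℚ; ½)
import Data.Bool.Properties as Bool
open import Data.Fin.Subset using (Subset; inside; outside; Nonempty; Empty; _∩_; ⋃; ⊤)
open import Data.Fin.Subset.Properties using (nonempty?)
open import Data.List.Base using (List; []; _∷_; _++_; map; filter; foldr; length; applyUpTo)
open import Data.List.Relation.Unary.All using (All; all?)
open import Data.List.Relation.Unary.AllPairs using (AllPairs; allPairs?)
open import Data.Product.Base using (_×_)
import Data.Vec.Base as Vec
import Data.Vec.Properties as Vec
open import Relation.Binary.PropositionalEquality using (_≡_; refl)
open import Relation.Nullary.Decidable using (Dec; _×-dec_; ¬?)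

subsets : ∀ n → List (Subset n)
subsets zero    = Vec.[] ∷ []
subsets (suc n) = map (outside Vec.∷_) (subsets n) ++ map (inside Vec.∷_) (subsets n)

sublists : ∀ {A : Set} → List A → List (List A)
sublists []       = [] ∷ []
sublists (x ∷ xs) = sublists xs ++ map (x ∷_) (sublists xs)

-- Every subset of Fin n occurs exactly once in subsets n, so every set of
-- subsets of Fin n is represented by exactly one element of this list.
families : ∀ n → List (List (Subset n))
families n = sublists (subsets n)

Disjoint : ∀ {n} → Subset n → Subset n → Set
Disjoint p q = Empty (p ∩ q)

IsPartition : ∀ {n} → ℕ → List (Subset n) → Set
IsPartition k blocks =
  length blocks ≡ k × All Nonempty blocks × AllPairs Disjoint blocks × ⋃ blocks ≡ ⊤

isPartition? : ∀ {n} k (blocks : List (Subset n)) → Dec (IsPartition k blocks)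
isPartition? k blocks =
  length blocks ℕ.≟ k
    ×-dec all? nonempty? blocks
    ×-dec allPairs? (λ p q → ¬? (nonempty? (p ∩ q))) blocks
    ×-dec Vec.≡-dec Bool._≟_ (⋃ blocks) ⊤

stirling₂ : ℕ → ℕ → ℕ
stirling₂ n k = length (filter (isPartition? k) (families n))

lucas : ℕ → ℕ
lucas 0             = 2
lucas 1             = 1
lucas (suc (suc m)) = lucas (suc m) ℕ.+ lucas m

lucasFubini : ℕ → ℕ
lucasFubini n = sum (applyUpTo (λ k → lucas (suc k) ℕ.* stirling₂ n k) (suc n))

-- a +√5· b stands for a + b√5. Since √5 is irrational and ℚ is kept in lowest
-- terms, propositional equality is equality of numbers.
infix 5 _+√5·_

record ℚ[√5] : Set where
  constructor _+√5·_
  field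
    rat : ℚ
    irr : ℚ

infixl 6 _+_ _-_
infixl 7 _*_

fromℚ : ℚ → ℚ[√5]
fromℚ q = q +√5· 0ℚ

0# 1# √5 : ℚ[√5]
0# = fromℚ 0ℚ
1# = fromℚ 1ℚ
√5 = 0ℚ +√5· 1ℚ

_+_ _-_ _*_ : ℚ[√5] → ℚ[√5] → ℚ[√5]
(a +√5· b) + (c +√5· d) = (a ℚ.+ c) +√5· (b ℚ.+ d)
(a +√5· b) - (c +√5· d) = (a ℚ.- c) +√5· (b ℚ.- d)
(a +√5· b) * (c +√5· d) =
  (a ℚ.* c ℚ.+ (+ 5 ℚ./ 1) ℚ.* (b ℚ.* d)) +√5· (a ℚ.* d ℚ.+ b ℚ.* c)

√5*√5≡5 : √5 * √5 ≡ fromℚ (+ 5 ℚ./ 1)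
√5*√5≡5 = refl

α β : ℚ[√5]
α = fromℚ ½ * (1# + √5)
β = fromℚ ½ * (1# - √5)

-- Coefficient sequences of formal power series in t.
Series : Set
Series = ℕ → ℚ[√5]

infix  4 _≈_
infixl 6 _+ˢ_ _-ˢ_
infixl 7 _*ˢ_
infixr 7 _·_
infixr 8 _^ˢ_

_≈_ : Series → Series → Set
F ≈ G = ∀ n → F n ≡ G n

∑≤ : ℕ → (ℕ → ℚ[√5]) → ℚ[√5]
∑≤ n f = foldr _+_ 0# (applyUpTo f (suc n))

1ˢ : Series
1ˢ zero    = 1#
1ˢ (suc _) = 0#

_+ˢ_ _-ˢ_ _*ˢ_ : Series → Series → Series
(F +ˢ G) n = F n + G n
(F -ˢ G) n = F n - G n
(F *ˢ G) n = ∑≤ n (λ i → F i * G (n ∸ i))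

_·_ : ℚ[√5] → Series → Series
(c · F) n = c * F n

_^ˢ_ : Series → ℕ → Series
F ^ˢ zero  = 1ˢ
F ^ˢ suc k = F *ˢ F ^ˢ k

-- The composite F(G(t)) = ∑ₖ Fₖ G(t)ᵏ. When G has zero constant term, Gᵏ has
-- no terms of degree below k, so only k ≤ n contribute to the coefficient of tⁿ.
compose : (F G : Series) → .(G 0 ≡ 0#) → Series
compose F G _ n = ∑≤ n (λ k → F k * (G ^ˢ k) n)

egf : (ℕ → ℕ) → Series
egf a n = fromℚ (ℚ._/_ (+ a n) (n !) {{n !≢0}})

eᵗ : Series
eᵗ = egf (λ _ → 1)

exp : (G : Series) → .(G 0 ≡ 0#) → Series
exp G G₀≡0 = compose eᵗ G G₀≡0

{-# OPTIONS --safe #-}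

-- Splitting off the block that contains the first of n + 1 elements gives
-- S(n+1, k+1) = ∑ⱼ C(n, j) S(j, k), so the exponential generating function S_k(t) of S(-, k)
-- satisfies S_{k+1}′ = eᵗ S_k. The series (eᵗ − 1)ᵏ / k! satisfies the same recurrence and
-- has the same constant term, hence S_k = (eᵗ − 1)ᵏ / k!. The theorem follows by multiplying
-- with the Binet formula L_{k+1} = αᵏ⁺¹ + βᵏ⁺¹ and summing over k.
module Submission where

open import Algebra.Bundles using (CommutativeSemiring)
import Algebra.Properties.CommutativeSemigroup
import Algebra.Properties.Semiring.Exp
import Algebra.Solver.Ring.NaturalCoefficients.Default
open import Algebra.Structures using (IsCommutativeSemiring)
open import Algebra.Structures.Biased using (isCommutativeMonoidˡ; isCommutativeSemiringˡ)
open import Data.Bool.Base using (true; false; if_then_else_)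
import Data.Bool.Properties as Bool
open import Data.Fin.Base using (zero; suc)
open import Data.Fin.Subset using (Subset; inside; outside; Nonempty; ⊤; ⋃; _∈_; _⊆_; _∩_; _∪_; _─_; ∣_∣)
open import Data.Fin.Subset.Properties
  using (nonempty?; drop-∷-⊆; _⊆?_; p⊆p∪q; q⊆p∪q; x∈p∪q⁻; x∈p∩q⁺; x∈p∩q⁻; ∪-assoc; ∪-identityˡ; ∪-identityʳ; ∉⊥; ∣⊤∣≡n)
open import Data.Integer.Base as ℤ using () renaming (+_ to pos)
import Data.Integer.Properties as ℤ
open import Data.List.Base using (List; []; _∷_; [_]; _++_; map; filter; length; applyUpTo)
open import Data.List.Membership.Propositional using () renaming (_∈_ to _∈ˡ_)
open import Data.List.Membership.Propositional.Properties using (∈-++⁺ʳ)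
open import Data.List.Properties using (++-identityʳ; filter-++; length-++; length-map; map-++; map-∘; map-cong)
open import Data.List.Relation.Unary.All as All using (All; []; _∷_)
import Data.List.Relation.Unary.All.Properties as All
open import Data.List.Relation.Unary.AllPairs as AllPairs using (AllPairs; []; _∷_; allPairs?)
import Data.List.Relation.Unary.AllPairs.Properties as AllPairs
open import Data.List.Relation.Unary.Any using (here; there)
open import Data.Nat.Base as ℕ using (ℕ; zero; suc; _!)
open import Data.Nat.ListAction using (sum)
open import Data.Nat.ListAction.Properties using (sum-++)
open import Data.Nat.Properties using (_!≢0)
import Data.Nat.Properties as ℕ
open import Data.Product.Base using (_×_; _,_; proj₁; proj₂)
open import Data.Rational.Base as ℚ using (ℚ; 0ℚ; 1ℚ)
import Data.Rational.Properties as ℚ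
import Data.Rational.Solver as ℚ
import Data.Rational.Unnormalised.Base as ℚᵘ
import Data.Rational.Unnormalised.Properties as ℚᵘ
open import Data.Sum.Base using (inj₁; inj₂)
import Data.Vec.Base as Vec
import Data.Vec.Properties as Vec
open import Function.Base using (_∘_; const)
open import Relation.Binary.PropositionalEquality
  using (_≡_; _≗_; refl; sym; trans; cong; cong₂; subst; isEquivalence; module ≡-Reasoning)
open import Relation.Nullary using (Dec; yes; no; does; ¬_; contradiction)
open import Relation.Nullary.Decidable using (_×-dec_; ¬?)
open import Relation.Unary using (Decidable)
open import Defs

-- `stirling₂` tests lists of subsets and has no recursion of its own. Since `subsets (suc n)` lists
-- the subsets without the first element before those with it, every sublist is `u ++ v` split along
-- that line, and in a partition of a ground set containing the first element `v` is a single block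
-- B. What is left partitions a subset and not some `Fin m`; hence the ground set is kept arbitrary
-- and the count is shown to depend on its size alone. The comparison of S_k with (eᵗ - 1)ᵏ / k! is
-- carried out on natural numbers, as (eᵗ - 1) S_k = (k + 1) S_{k+1}, with the shift `a ∘ suc` as
-- derivative. Denominators enter only when `egf` carries `⊛` to the product of series. Both sides
-- of the theorem have, at tⁿ, a sum over k ≤ n, so they are compared term by term.

module ℕ+ = Algebra.Properties.CommutativeSemigroup ℕ.+-commutativeSemigroup
module ℕ* = Algebra.Properties.CommutativeSemigroup ℕ.*-commutativeSemigroup

-- Arithmetic of the coefficient ring

5ℚ : ℚ
5ℚ = pos 5 ℚ./ 1

ℚ[√5]-isCommutativeSemiring : IsCommutativeSemiring _≡_ _+_ _*_ 0# 1#
ℚ[√5]-isCommutativeSemiring = isCommutativeSemiringˡ record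
  { +-isCommutativeMonoid = isCommutativeMonoidˡ record
    { isSemigroup = record
      { isMagma = record { isEquivalence = isEquivalence ; ∙-cong = cong₂ _+_ }
      ; assoc   = λ (a +√5· b) (c +√5· d) (e +√5· f) → cong₂ _+√5·_ (ℚ.+-assoc a c e) (ℚ.+-assoc b d f)
      }
    ; identityˡ = λ (a +√5· b) → cong₂ _+√5·_ (ℚ.+-identityˡ a) (ℚ.+-identityˡ b)
    ; comm      = λ (a +√5· b) (c +√5· d) → cong₂ _+√5·_ (ℚ.+-comm a c) (ℚ.+-comm b d)
    }
  ; *-isCommutativeMonoid = isCommutativeMonoidˡ record
    { isSemigroup = record
      { isMagma = record { isEquivalence = isEquivalence ; ∙-cong = cong₂ _*_ }
      ; assoc   = λ (a +√5· b) (c +√5· d) (e +√5· f) → cong₂ _+√5·_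
          -- The variable `s` stands for 5: the laws hold for an adjoined square root of any `s`.
          (solve 7 (λ a b c d e f s →
            (a :* c :+ s :* (b :* d)) :* e :+ s :* ((a :* d :+ b :* c) :* f) :=
            a :* (c :* e :+ s :* (d :* f)) :+ s :* (b :* (c :* f :+ d :* e))) refl a b c d e f 5ℚ)
          (solve 7 (λ a b c d e f s →
            (a :* c :+ s :* (b :* d)) :* f :+ (a :* d :+ b :* c) :* e :=
            a :* (c :* f :+ d :* e) :+ b :* (c :* e :+ s :* (d :* f))) refl a b c d e f 5ℚ)
      }
    ; identityˡ = λ (a +√5· b) → cong₂ _+√5·_
        (solve 3 (λ a b s → con 1ℚ :* a :+ s :* (con 0ℚ :* b) := a) refl a b 5ℚ)
        (solve 2 (λ a b → con 1ℚ :* b :+ con 0ℚ :* a := b) refl a b)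
    ; comm      = λ (a +√5· b) (c +√5· d) → cong₂ _+√5·_
        (solve 5 (λ a b c d s → a :* c :+ s :* (b :* d) := c :* a :+ s :* (d :* b)) refl a b c d 5ℚ)
        (solve 4 (λ a b c d → a :* d :+ b :* c := c :* b :+ d :* a) refl a b c d)
    }
  ; distribʳ = λ (a +√5· b) (c +√5· d) (e +√5· f) → cong₂ _+√5·_
      (solve 7 (λ a b c d e f s →
        (c :+ e) :* a :+ s :* ((d :+ f) :* b) :=
        (c :* a :+ s :* (d :* b)) :+ (e :* a :+ s :* (f :* b))) refl a b c d e f 5ℚ)
      (solve 6 (λ a b c d e f →
        (c :+ e) :* b :+ (d :+ f) :* a :=
        (c :* b :+ d :* a) :+ (e :* b :+ f :* a)) refl a b c d e f)
  ; zeroˡ = λ (a +√5· b) → cong₂ _+√5·_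
      (solve 3 (λ a b s → con 0ℚ :* a :+ s :* (con 0ℚ :* b) := con 0ℚ) refl a b 5ℚ)
      (solve 2 (λ a b → con 0ℚ :* b :+ con 0ℚ :* a := con 0ℚ) refl a b)
  }
  where open ℚ.+-*-Solver

ℚ[√5]-commutativeSemiring : CommutativeSemiring _ _
ℚ[√5]-commutativeSemiring = record { isCommutativeSemiring = ℚ[√5]-isCommutativeSemiring }

module ℚ√5 = CommutativeSemiring ℚ[√5]-commutativeSemiring
open Algebra.Properties.Semiring.Exp ℚ√5.semiring using (_^_)
open Algebra.Solver.Ring.NaturalCoefficients.Default ℚ[√5]-commutativeSemiring
  using (solve; con; _:+_; _:*_; _:=_)

-- Fractions of natural numbers as coefficients

fromℚ-* : ∀ p q → fromℚ p * fromℚ q ≡ fromℚ (p ℚ.* q)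
fromℚ-* p q = cong₂ _+√5·_ (trans (cong (p ℚ.* q ℚ.+_) (ℚ.*-zeroʳ 5ℚ)) (ℚ.+-identityʳ _))
  (cong₂ ℚ._+_ (ℚ.*-zeroʳ p) (ℚ.*-zeroˡ q))

-- Normalisation by the gcd does not compute on variables, so the product is taken among
-- unnormalised rationals, where equality is cross-multiplication. The fraction identities for
-- factorials below are all instances.
/-*-/ : ∀ a b c m n d .{{_ : ℕ.NonZero m}} .{{_ : ℕ.NonZero n}} .{{_ : ℕ.NonZero d}} →
        a ℕ.* b ℕ.* d ≡ c ℕ.* (m ℕ.* n) → (pos a ℚ./ m) ℚ.* (pos b ℚ./ n) ≡ pos c ℚ./ d
/-*-/ a b c m@(suc m-1) n@(suc n-1) d@(suc d-1) eq = ℚ.toℚᵘ-injective (begin-equality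
  ℚ.toℚᵘ ((pos a ℚ./ m) ℚ.* (pos b ℚ./ n))
    ≃⟨ ℚ.toℚᵘ-homo-* (pos a ℚ./ m) (pos b ℚ./ n) ⟩
  ℚ.toℚᵘ (pos a ℚ./ m) ℚᵘ.* ℚ.toℚᵘ (pos b ℚ./ n)
    ≃⟨ ℚᵘ.*-cong (ℚ.toℚᵘ-fromℚᵘ (ℚᵘ.mkℚᵘ (pos a) m-1)) (ℚ.toℚᵘ-fromℚᵘ (ℚᵘ.mkℚᵘ (pos b) n-1)) ⟩
  ℚᵘ.mkℚᵘ (pos a) m-1 ℚᵘ.* ℚᵘ.mkℚᵘ (pos b) n-1
    ≃⟨ ℚᵘ.*≡* cross ⟩
  ℚᵘ.mkℚᵘ (pos c) d-1
    ≃⟨ ℚ.toℚᵘ-fromℚᵘ (ℚᵘ.mkℚᵘ (pos c) d-1) ⟨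
  ℚ.toℚᵘ (pos c ℚ./ d) ∎)
  where
  open ℚᵘ.≤-Reasoning
  cross : pos a ℤ.* pos b ℤ.* pos d ≡ pos c ℤ.* pos (m ℕ.* n)
  cross = trans (cong (ℤ._* pos d) (sym (ℤ.pos-* a b)))
    (trans (sym (ℤ.pos-* (a ℕ.* b) d)) (trans (cong pos eq) (ℤ.pos-* c (m ℕ.* n))))

fromℚ-/-* : ∀ a b c m n d .{{_ : ℕ.NonZero m}} .{{_ : ℕ.NonZero n}} .{{_ : ℕ.NonZero d}} →
            a ℕ.* b ℕ.* d ≡ c ℕ.* (m ℕ.* n) →
            fromℚ (pos a ℚ./ m) * fromℚ (pos b ℚ./ n) ≡ fromℚ (pos c ℚ./ d)
fromℚ-/-* a b c m n d eq =
  trans (fromℚ-* (pos a ℚ./ m) (pos b ℚ./ n)) (cong fromℚ (/-*-/ a b c m n d eq))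

ι : ℕ → ℚ[√5]
ι a = fromℚ (pos a ℚ./ 1)

/1-+ : ∀ a b → pos (a ℕ.+ b) ℚ./ 1 ≡ (pos a ℚ./ 1) ℚ.+ (pos b ℚ./ 1)
/1-+ a b = ℚ.toℚᵘ-injective (begin-equality
  ℚ.toℚᵘ (pos (a ℕ.+ b) ℚ./ 1)
    ≃⟨ ℚ.toℚᵘ-fromℚᵘ (ℚᵘ.mkℚᵘ (pos (a ℕ.+ b)) 0) ⟩
  ℚᵘ.mkℚᵘ (pos (a ℕ.+ b)) 0
    ≃⟨ ℚᵘ.*≡* (cong (ℤ._* pos 1) (sym (cong₂ ℤ._+_ (ℤ.*-identityʳ (pos a)) (ℤ.*-identityʳ (pos b))))) ⟩
  ℚᵘ.mkℚᵘ (pos a) 0 ℚᵘ.+ ℚᵘ.mkℚᵘ (pos b) 0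
    ≃⟨ ℚᵘ.+-cong (ℚ.toℚᵘ-fromℚᵘ (ℚᵘ.mkℚᵘ (pos a) 0)) (ℚ.toℚᵘ-fromℚᵘ (ℚᵘ.mkℚᵘ (pos b) 0)) ⟨
  ℚ.toℚᵘ (pos a ℚ./ 1) ℚᵘ.+ ℚ.toℚᵘ (pos b ℚ./ 1)
    ≃⟨ ℚ.toℚᵘ-homo-+ (pos a ℚ./ 1) (pos b ℚ./ 1) ⟨
  ℚ.toℚᵘ ((pos a ℚ./ 1) ℚ.+ (pos b ℚ./ 1)) ∎)
  where open ℚᵘ.≤-Reasoning

ι-+ : ∀ a b → ι (a ℕ.+ b) ≡ ι a + ι b
ι-+ a b = cong fromℚ (/1-+ a b)

open ≡-Reasoning

ι-* : ∀ a b → ι (a ℕ.* b) ≡ ι a * ι b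
ι-* a b = sym (fromℚ-/-* a b (a ℕ.* b) 1 1 1 refl)

-- `eᵗ n` is 1/n!, so the division is confined to one factor and identities of `egf` reduce to
-- semiring laws on numerators.
egf≡ι*eᵗ : ∀ A n → egf A n ≡ ι (A n) * eᵗ n
egf≡ι*eᵗ A n = sym (fromℚ-/-* (A n) 1 (A n) 1 (n !) (n !) {{_}} {{n !≢0}} {{n !≢0}}
  (ℕ.*-assoc (A n) 1 (n !)))

ι!*eᵗ : ∀ n → ι (n !) * eᵗ n ≡ 1#
ι!*eᵗ n = fromℚ-/-* (n !) 1 1 1 (n !) 1 {{_}} {{n !≢0}}
  (trans (ℕ.*-identityʳ _) (trans (ℕ.*-comm (n !) 1) (sym (ℕ.*-identityˡ _))))

-- The coefficient form of (eᵗ)′ = eᵗ.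
ι*eᵗ-suc : ∀ n → ι (suc n) * eᵗ (suc n) ≡ eᵗ n
ι*eᵗ-suc n = fromℚ-/-* (suc n) 1 1 1 (suc n !) (n !) {{_}} {{suc n !≢0}} {{n !≢0}}
  (trans (cong (ℕ._* n !) (ℕ.*-identityʳ (suc n))) (sym (trans (ℕ.*-identityˡ _) (ℕ.*-identityˡ _))))

-- Recovers coefficient n + 1 of a series from coefficient n of its derivative, so series can be
-- compared through their derivatives.
ι-cancelˡ : ∀ n {x y} → ι (suc n) * x ≡ ι (suc n) * y → x ≡ y
ι-cancelˡ n {x} {y} eq = begin
  x                        ≡⟨ ℚ√5.*-identityˡ x ⟨
  1# * x                   ≡⟨ cong (_* x) inverse ⟨
  ι⁻¹ * ι (suc n) * x      ≡⟨ ℚ√5.*-assoc ι⁻¹ _ x ⟩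
  ι⁻¹ * (ι (suc n) * x)    ≡⟨ cong (ι⁻¹ *_) eq ⟩
  ι⁻¹ * (ι (suc n) * y)    ≡⟨ ℚ√5.*-assoc ι⁻¹ _ y ⟨
  ι⁻¹ * ι (suc n) * y      ≡⟨ cong (_* y) inverse ⟩
  1# * y                   ≡⟨ ℚ√5.*-identityˡ y ⟩
  y                        ∎
  where
  ι⁻¹ : ℚ[√5]
  ι⁻¹ = fromℚ (pos 1 ℚ./ suc n)
  inverse : ι⁻¹ * ι (suc n) ≡ 1#
  inverse = fromℚ-/-* 1 (suc n) 1 (suc n) 1 1 (ℕ.*-assoc 1 (suc n) 1)

-- Binomial convolution

-- ∑ᵢ C(n, i) aᵢ bₙ₋ᵢ; the Leibniz rule for shifts avoids binomial coefficients.
infixl 7 _⊛_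

_⊛_ : (ℕ → ℕ) → (ℕ → ℕ) → ℕ → ℕ
(a ⊛ b) zero    = a 0 ℕ.* b 0
(a ⊛ b) (suc n) = (a ∘ suc ⊛ b) n ℕ.+ (a ⊛ b ∘ suc) n

⊛-cong : ∀ {a a′ b b′ : ℕ → ℕ} → a ≗ a′ → b ≗ b′ → a ⊛ b ≗ a′ ⊛ b′
⊛-cong a≗a′ b≗b′ zero    = cong₂ ℕ._*_ (a≗a′ 0) (b≗b′ 0)
⊛-cong a≗a′ b≗b′ (suc n) = cong₂ ℕ._+_ (⊛-cong (a≗a′ ∘ suc) b≗b′ n) (⊛-cong a≗a′ (b≗b′ ∘ suc) n)

⊛-scaleʳ : ∀ a c b → a ⊛ (λ n → c ℕ.* b n) ≗ (λ n → c ℕ.* (a ⊛ b) n)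
⊛-scaleʳ a c b zero    = ℕ*.x∙yz≈y∙xz (a 0) c (b 0)
⊛-scaleʳ a c b (suc n) = trans
  (cong₂ ℕ._+_ (⊛-scaleʳ (a ∘ suc) c b n) (⊛-scaleʳ a c (b ∘ suc) n)) (sym (ℕ.*-distribˡ-+ c _ _))

⊛-distribˡ-+ : ∀ a b c → a ⊛ (λ n → b n ℕ.+ c n) ≗ (λ n → (a ⊛ b) n ℕ.+ (a ⊛ c) n)
⊛-distribˡ-+ a b c zero    = ℕ.*-distribˡ-+ (a 0) (b 0) (c 0)
⊛-distribˡ-+ a b c (suc n) = trans
  (cong₂ ℕ._+_ (⊛-distribˡ-+ (a ∘ suc) b c n) (⊛-distribˡ-+ a (b ∘ suc) (c ∘ suc) n))
  (ℕ+.interchange ((a ∘ suc ⊛ b) n) _ _ _)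

-- The Leibniz rule gives three terms on either side, one for each factor that is shifted, and the
-- induction hypothesis matches them in pairs. This single law replaces associativity and
-- commutativity of `⊛`.
⊛-left-comm : ∀ a b c → a ⊛ (b ⊛ c) ≗ b ⊛ (a ⊛ c)
⊛-left-comm a b c zero    = ℕ*.x∙yz≈y∙xz (a 0) (b 0) (c 0)
⊛-left-comm a b c (suc n) = begin
  (a ∘ suc ⊛ (b ⊛ c)) n ℕ.+ (a ⊛ (b ⊛ c) ∘ suc) n
    ≡⟨ cong ((a ∘ suc ⊛ (b ⊛ c)) n ℕ.+_) (⊛-distribˡ-+ a (b ∘ suc ⊛ c) (b ⊛ c ∘ suc) n) ⟩
  (a ∘ suc ⊛ (b ⊛ c)) n ℕ.+ ((a ⊛ (b ∘ suc ⊛ c)) n ℕ.+ (a ⊛ (b ⊛ c ∘ suc)) n)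
    ≡⟨ cong₂ ℕ._+_ (⊛-left-comm (a ∘ suc) b c n)
         (cong₂ ℕ._+_ (⊛-left-comm a (b ∘ suc) c n) (⊛-left-comm a b (c ∘ suc) n)) ⟩
  (b ⊛ (a ∘ suc ⊛ c)) n ℕ.+ ((b ∘ suc ⊛ (a ⊛ c)) n ℕ.+ (b ⊛ (a ⊛ c ∘ suc)) n)
    ≡⟨ ℕ+.x∙yz≈y∙xz ((b ⊛ (a ∘ suc ⊛ c)) n) ((b ∘ suc ⊛ (a ⊛ c)) n) ((b ⊛ (a ⊛ c ∘ suc)) n) ⟩
  (b ∘ suc ⊛ (a ⊛ c)) n ℕ.+ ((b ⊛ (a ∘ suc ⊛ c)) n ℕ.+ (b ⊛ (a ⊛ c ∘ suc)) n)
    ≡⟨ cong ((b ∘ suc ⊛ (a ⊛ c)) n ℕ.+_) (⊛-distribˡ-+ b (a ∘ suc ⊛ c) (a ⊛ c ∘ suc) n) ⟨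
  (b ∘ suc ⊛ (a ⊛ c)) n ℕ.+ (b ⊛ (a ⊛ c) ∘ suc) n ∎

⊛-zeroʳ : ∀ a → a ⊛ const 0 ≗ const 0
⊛-zeroʳ a = ⊛-scaleʳ a 0 (const 0)

-- blockCount k n counts the partitions of n elements into k blocks: the elements outside the
-- block of the first one are chosen freely and partitioned into one block fewer.
blockCount : ℕ → ℕ → ℕ
blockCount zero    zero    = 1
blockCount zero    (suc n) = 0
blockCount (suc k) zero    = 0
blockCount (suc k) (suc n) = (const 1 ⊛ blockCount k) n

-- n! times the coefficients of eᵗ − 1.
nonzero : ℕ → ℕ
nonzero zero    = 0
nonzero (suc _) = 1

-- This is (eᵗ - 1) S_k = (k + 1) S_{k+1}. Both sides vanish at 0, and for k > 0 the left derivative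
-- is eᵗ S_k + (eᵗ - 1) eᵗ S_{k-1}, where induction on k turns the second term into k eᵗ S_k; the
-- total is (k + 1) S_{k+1}′.
nonzero-⊛-blockCount : ∀ k n → (nonzero ⊛ blockCount k) n ≡ suc k ℕ.* blockCount (suc k) n
nonzero-⊛-blockCount k       zero    = sym (ℕ.*-zeroʳ (suc k))
nonzero-⊛-blockCount zero    (suc n) = cong (blockCount 1 (suc n) ℕ.+_) (⊛-zeroʳ nonzero n)
-- `nonzero ∘ suc` is `const 1`, so the first Leibniz term is already one copy of the count; the
-- second has to supply the other `suc k`.
nonzero-⊛-blockCount (suc k) (suc n) = cong (blockCount (suc (suc k)) (suc n) ℕ.+_) (begin
  (nonzero ⊛ (const 1 ⊛ blockCount k)) n         ≡⟨ ⊛-left-comm nonzero (const 1) (blockCount k) n ⟩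
  (const 1 ⊛ (nonzero ⊛ blockCount k)) n         ≡⟨ ⊛-cong (λ _ → refl) (nonzero-⊛-blockCount k) n ⟩
  (const 1 ⊛ (λ m → suc k ℕ.* blockCount (suc k) m)) n ≡⟨ ⊛-scaleʳ (const 1) (suc k) (blockCount (suc k)) n ⟩
  suc k ℕ.* (const 1 ⊛ blockCount (suc k)) n     ∎)

-- Power series

∑≤-cong : ∀ {f g : ℕ → ℚ[√5]} n → f ≗ g → ∑≤ n f ≡ ∑≤ n g
∑≤-cong zero    f≗g = cong (_+ 0#) (f≗g 0)
∑≤-cong (suc n) f≗g = cong₂ _+_ (f≗g 0) (∑≤-cong n (f≗g ∘ suc))

∑≤-+ : ∀ (f g : ℕ → ℚ[√5]) n → ∑≤ n (λ k → f k + g k) ≡ ∑≤ n f + ∑≤ n g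
∑≤-+ f g zero    = solve 2 (λ x y → x :+ y :+ con 0 := (x :+ con 0) :+ (y :+ con 0)) refl (f 0) (g 0)
∑≤-+ f g (suc n) = trans (cong (f 0 + g 0 +_) (∑≤-+ (f ∘ suc) (g ∘ suc) n))
  (solve 4 (λ x y z w → x :+ y :+ (z :+ w) := (x :+ z) :+ (y :+ w)) refl (f 0) (g 0) _ _)

∑≤-*ˡ : ∀ c (f : ℕ → ℚ[√5]) n → ∑≤ n (λ k → c * f k) ≡ c * ∑≤ n f
∑≤-*ˡ c f zero    = solve 2 (λ c x → c :* x :+ con 0 := c :* (x :+ con 0)) refl c (f 0)
∑≤-*ˡ c f (suc n) = trans (cong (c * f 0 +_) (∑≤-*ˡ c (f ∘ suc) n)) (sym (ℚ√5.distribˡ c (f 0) _))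

ι-sum : ∀ (f : ℕ → ℕ) n → ι (sum (applyUpTo f (suc n))) ≡ ∑≤ n (ι ∘ f)
ι-sum f zero    = ι-+ (f 0) 0
ι-sum f (suc n) = trans (ι-+ (f 0) _) (cong (ι (f 0) +_) (ι-sum (f ∘ suc) n))

*ˢ-cong : ∀ {F F′ G G′} → F ≈ F′ → G ≈ G′ → F *ˢ G ≈ F′ *ˢ G′
*ˢ-cong F≈F′ G≈G′ n = ∑≤-cong n (λ i → cong₂ _*_ (F≈F′ i) (G≈G′ (n ℕ.∸ i)))

*ˢ-distribʳ-+ˢ : ∀ F G H → (F +ˢ G) *ˢ H ≈ F *ˢ H +ˢ G *ˢ H
*ˢ-distribʳ-+ˢ F G H n = trans
  (∑≤-cong n (λ i → ℚ√5.distribʳ (H (n ℕ.∸ i)) (F i) (G i)))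
  (∑≤-+ (λ i → F i * H (n ℕ.∸ i)) (λ i → G i * H (n ℕ.∸ i)) n)

·-*ˢ-· : ∀ c d F G → (c · F) *ˢ (d · G) ≈ (c * d) · (F *ˢ G)
·-*ˢ-· c d F G n = trans
  (∑≤-cong n (λ i → solve 4 (λ c d x y → c :* x :* (d :* y) := c :* d :* (x :* y)) refl c d (F i) (G (n ℕ.∸ i))))
  (∑≤-*ˡ (c * d) (λ i → F i * G (n ℕ.∸ i)) n)

derivative : Series → Series
derivative F n = ι (suc n) * F (suc n)

-- Writing F = F₀ + t G gives F′ = G + t G′; this is the tail of that identity.
derivative-suc : ∀ F → derivative F ∘ suc ≈ F ∘ ℕ.suc ∘ ℕ.suc +ˢ derivative (F ∘ suc)
derivative-suc F n = trans (cong (_* F (suc (suc n))) (ι-+ 1 (suc n)))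
  (solve 2 (λ x y → (con 1 :+ x) :* y := y :+ x :* y) refl (ι (suc n)) (F (suc (suc n))))

-- Induction on n through (F *ˢ G) (suc n) = F 0 * G (suc n) + ((F ∘ suc) *ˢ G) n, which holds by computation.
derivative-*ˢ : ∀ F G → derivative (F *ˢ G) ≈ derivative F *ˢ G +ˢ F *ˢ derivative G
derivative-*ˢ F G zero =
  solve 4 (λ f₀ f₁ g₀ g₁ → con 1 :* (f₀ :* g₁ :+ (f₁ :* g₀ :+ con 0)) :=
    con 1 :* f₁ :* g₀ :+ con 0 :+ (f₀ :* (con 1 :* g₁) :+ con 0)) refl (F 0) (F 1) (G 0) (G 1)
derivative-*ˢ F G (suc n) = begin
  ι (suc (suc n)) * (F 0 * G (suc (suc n)) + C)
    ≡⟨ cong (_* (F 0 * G (suc (suc n)) + C)) (ι-+ 1 (suc n)) ⟩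
  (1# + ι (suc n)) * (F 0 * G (suc (suc n)) + C)
    ≡⟨ solve 4 (λ i f g c → (con 1 :+ i) :* (f :* g :+ c) := f :* ((con 1 :+ i) :* g) :+ c :+ i :* c)
         refl (ι (suc n)) (F 0) (G (suc (suc n))) C ⟩
  F 0 * ((1# + ι (suc n)) * G (suc (suc n))) + C + ι (suc n) * C
    ≡⟨ cong₂ (λ x y → F 0 * (x * G (suc (suc n))) + C + y) (sym (ι-+ 1 (suc n))) (derivative-*ˢ (F ∘ suc) G n) ⟩
  F 0 * derivative G (suc n) + (F 1 * G (suc n) + P) + (Q + R)
    ≡⟨ solve 6 (λ x f g p q r → x :+ (f :* g :+ p) :+ (q :+ r) := con 1 :* f :* g :+ (p :+ q) :+ (x :+ r))
         refl (F 0 * derivative G (suc n)) (F 1) (G (suc n)) P Q R ⟩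
  derivative F 0 * G (suc n) + (P + Q) + (F 0 * derivative G (suc n) + R)
    ≡⟨ cong (λ x → derivative F 0 * G (suc n) + x + (F 0 * derivative G (suc n) + R))
         (sym (trans (*ˢ-cong {G = G} (derivative-suc F) (λ _ → refl) n)
                (*ˢ-distribʳ-+ˢ (F ∘ ℕ.suc ∘ ℕ.suc) (derivative (F ∘ suc)) G n))) ⟩
  (derivative F *ˢ G) (suc n) + (F *ˢ derivative G) (suc n) ∎
  where
  C P Q R : ℚ[√5]
  C = ((F ∘ suc) *ˢ G) (suc n)
  P = ((F ∘ ℕ.suc ∘ ℕ.suc) *ˢ G) n
  Q = (derivative (F ∘ suc) *ˢ G) n
  R = ((F ∘ suc) *ˢ derivative G) n

derivative-egf : ∀ A → derivative (egf A) ≈ egf (A ∘ suc)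
derivative-egf A n = begin
  ι (suc n) * egf A (suc n)                ≡⟨ cong (ι (suc n) *_) (egf≡ι*eᵗ A (suc n)) ⟩
  ι (suc n) * (ι (A (suc n)) * eᵗ (suc n))
    ≡⟨ solve 3 (λ x y z → x :* (y :* z) := y :* (x :* z)) refl (ι (suc n)) (ι (A (suc n))) (eᵗ (suc n)) ⟩
  ι (A (suc n)) * (ι (suc n) * eᵗ (suc n)) ≡⟨ cong (ι (A (suc n)) *_) (ι*eᵗ-suc n) ⟩
  ι (A (suc n)) * eᵗ n                     ≡⟨ egf≡ι*eᵗ (A ∘ suc) n ⟨
  egf (A ∘ suc) n                          ∎

egf-+ : ∀ A B n → egf (λ i → A i ℕ.+ B i) n ≡ egf A n + egf B n
egf-+ A B n = begin
  egf (λ i → A i ℕ.+ B i) n       ≡⟨ egf≡ι*eᵗ (λ i → A i ℕ.+ B i) n ⟩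
  ι (A n ℕ.+ B n) * eᵗ n          ≡⟨ cong (_* eᵗ n) (ι-+ (A n) (B n)) ⟩
  (ι (A n) + ι (B n)) * eᵗ n      ≡⟨ ℚ√5.distribʳ (eᵗ n) (ι (A n)) (ι (B n)) ⟩
  ι (A n) * eᵗ n + ι (B n) * eᵗ n ≡⟨ cong₂ _+_ (egf≡ι*eᵗ A n) (egf≡ι*eᵗ B n) ⟨
  egf A n + egf B n               ∎

-- `⊛` is defined by the Leibniz rule, which the product of series also obeys. So the derivatives
-- agree by the induction hypothesis for the shifted sequences, and n + 1 cancels.
egf-⊛ : ∀ A B → egf A *ˢ egf B ≈ egf (A ⊛ B)
egf-⊛ A B zero    = trans (ℚ√5.+-identityʳ _) (sym (ι-* (A 0) (B 0)))
egf-⊛ A B (suc n) = ι-cancelˡ n (begin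
  derivative (egf A *ˢ egf B) n
    ≡⟨ derivative-*ˢ (egf A) (egf B) n ⟩
  (derivative (egf A) *ˢ egf B) n + (egf A *ˢ derivative (egf B)) n
    ≡⟨ cong₂ _+_ (*ˢ-cong {G = egf B} (derivative-egf A) (λ _ → refl) n)
                 (*ˢ-cong {F = egf A} (λ _ → refl) (derivative-egf B) n) ⟩
  (egf (A ∘ suc) *ˢ egf B) n + (egf A *ˢ egf (B ∘ suc)) n
    ≡⟨ cong₂ _+_ (egf-⊛ (A ∘ suc) B n) (egf-⊛ A (B ∘ suc) n) ⟩
  egf (A ∘ suc ⊛ B) n + egf (A ⊛ B ∘ suc) n
    ≡⟨ egf-+ (A ∘ suc ⊛ B) (A ⊛ B ∘ suc) n ⟨
  egf ((A ⊛ B) ∘ suc) n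
    ≡⟨ derivative-egf (A ⊛ B) n ⟨
  derivative (egf (A ⊛ B)) n ∎)

egf-cong : ∀ {A B} → A ≗ B → egf A ≈ egf B
egf-cong {A} {B} A≗B n =
  trans (egf≡ι*eᵗ A n) (trans (cong (λ a → ι a * eᵗ n) (A≗B n)) (sym (egf≡ι*eᵗ B n)))

-- Trades the subtraction for a sequence of natural numbers, so that semiring laws are enough from
-- here on.
eᵗ-1≈egf : eᵗ -ˢ 1ˢ ≈ egf nonzero
eᵗ-1≈egf zero    = refl
eᵗ-1≈egf (suc n) = cong₂ _+√5·_ (ℚ.+-identityʳ _) refl

1≈egf : 1ˢ ≈ egf (λ n → 0 ! ℕ.* blockCount 0 n)
1≈egf zero    = refl
1≈egf (suc n) = sym (trans (egf≡ι*eᵗ (const 0) (suc n)) (ℚ√5.zeroˡ (eᵗ (suc n))))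

-- A further factor eᵗ - 1 acts on the counts as `nonzero ⊛_`, which takes k! S_k to k! (k + 1)
-- S_{k+1}.
[c·[eᵗ-1]]^k : ∀ c k → (c · (eᵗ -ˢ 1ˢ)) ^ˢ k ≈ (c ^ k) · egf (λ n → k ! ℕ.* blockCount k n)
[c·[eᵗ-1]]^k c zero    n = trans (1≈egf n) (sym (ℚ√5.*-identityˡ _))
[c·[eᵗ-1]]^k c (suc k) n = begin
  ((c · (eᵗ -ˢ 1ˢ)) *ˢ (c · (eᵗ -ˢ 1ˢ)) ^ˢ k) n
    ≡⟨ *ˢ-cong (λ i → cong (c *_) (eᵗ-1≈egf i)) ([c·[eᵗ-1]]^k c k) n ⟩
  ((c · egf nonzero) *ˢ ((c ^ k) · egf (λ n → k ! ℕ.* blockCount k n))) n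
    ≡⟨ ·-*ˢ-· c (c ^ k) (egf nonzero) (egf (λ n → k ! ℕ.* blockCount k n)) n ⟩
  c ^ suc k * (egf nonzero *ˢ egf (λ n → k ! ℕ.* blockCount k n)) n
    ≡⟨ cong (c ^ suc k *_) (egf-⊛ nonzero (λ n → k ! ℕ.* blockCount k n) n) ⟩
  c ^ suc k * egf (nonzero ⊛ (λ n → k ! ℕ.* blockCount k n)) n
    ≡⟨ cong (c ^ suc k *_) (egf-cong counts n) ⟩
  c ^ suc k * egf (λ n → suc k ! ℕ.* blockCount (suc k) n) n ∎
  where
  counts : nonzero ⊛ (λ n → k ! ℕ.* blockCount k n) ≗ (λ n → suc k ! ℕ.* blockCount (suc k) n)
  counts n = begin
    (nonzero ⊛ (λ n → k ! ℕ.* blockCount k n)) n ≡⟨ ⊛-scaleʳ nonzero (k !) (blockCount k) n ⟩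
    k ! ℕ.* (nonzero ⊛ blockCount k) n           ≡⟨ cong (k ! ℕ.*_) (nonzero-⊛-blockCount k n) ⟩
    k ! ℕ.* (suc k ℕ.* blockCount (suc k) n)     ≡⟨ ℕ*.x∙yz≈yx∙z (k !) (suc k) _ ⟩
    suc k ! ℕ.* blockCount (suc k) n             ∎

-- The coefficient 1/k! of the exponential cancels the k! of the k-th power. The outer factor `c`
-- raises the exponent to `suc k`, the index of the Lucas number that it will meet.
c·exp[c·[eᵗ-1]] : ∀ c n → (c · exp (c · (eᵗ -ˢ 1ˢ)) (ℚ√5.zeroʳ c)) n ≡ ∑≤ n (λ k → c ^ suc k * egf (blockCount k) n)
c·exp[c·[eᵗ-1]] c n = begin
  c * ∑≤ n (λ k → eᵗ k * ((c · (eᵗ -ˢ 1ˢ)) ^ˢ k) n)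
    ≡⟨ ∑≤-*ˡ c (λ k → eᵗ k * ((c · (eᵗ -ˢ 1ˢ)) ^ˢ k) n) n ⟨
  ∑≤ n (λ k → c * (eᵗ k * ((c · (eᵗ -ˢ 1ˢ)) ^ˢ k) n))
    ≡⟨ ∑≤-cong n term ⟩
  ∑≤ n (λ k → c ^ suc k * egf (blockCount k) n) ∎
  where
  term : ∀ k → c * (eᵗ k * ((c · (eᵗ -ˢ 1ˢ)) ^ˢ k) n) ≡ c ^ suc k * egf (blockCount k) n
  term k = begin
    c * (eᵗ k * ((c · (eᵗ -ˢ 1ˢ)) ^ˢ k) n)
      ≡⟨ cong (λ x → c * (eᵗ k * x)) ([c·[eᵗ-1]]^k c k n) ⟩
    c * (eᵗ k * (c ^ k * egf (λ n → k ! ℕ.* blockCount k n) n))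
      ≡⟨ cong (λ x → c * (eᵗ k * (c ^ k * x))) (egf≡ι*eᵗ (λ n → k ! ℕ.* blockCount k n) n) ⟩
    c * (eᵗ k * (c ^ k * (ι (k ! ℕ.* blockCount k n) * eᵗ n)))
      ≡⟨ cong (λ x → c * (eᵗ k * (c ^ k * (x * eᵗ n)))) (ι-* (k !) (blockCount k n)) ⟩
    c * (eᵗ k * (c ^ k * (ι (k !) * ι (blockCount k n) * eᵗ n)))
      ≡⟨ solve 6 (λ c w p f b v → c :* (w :* (p :* (f :* b :* v))) := c :* p :* (f :* w :* (b :* v)))
           refl c (eᵗ k) (c ^ k) (ι (k !)) (ι (blockCount k n)) (eᵗ n) ⟩
    c ^ suc k * (ι (k !) * eᵗ k * (ι (blockCount k n) * eᵗ n))
      ≡⟨ cong₂ (λ x y → c ^ suc k * (x * y)) (ι!*eᵗ k) (sym (egf≡ι*eᵗ (blockCount k) n)) ⟩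
    c ^ suc k * (1# * egf (blockCount k) n)
      ≡⟨ cong (c ^ suc k *_) (ℚ√5.*-identityˡ _) ⟩
    c ^ suc k * egf (blockCount k) n ∎

-- Counting set partitions

indicator : ∀ {P : Set} → Dec P → ℕ
indicator P? = if does P? then 1 else 0

indicator-cong : ∀ {P Q : Set} (P? : Dec P) (Q? : Dec Q) → (P → Q) → (Q → P) → indicator P? ≡ indicator Q?
indicator-cong (yes p) (yes q) _ _ = refl
indicator-cong (yes p) (no ¬q) f _ = contradiction (f p) ¬q
indicator-cong (no ¬p) (yes q) _ g = contradiction (g q) ¬p
indicator-cong (no ¬p) (no ¬q) _ _ = refl

indicator-no : ∀ {P : Set} (P? : Dec P) → ¬ P → indicator P? ≡ 0
indicator-no (yes p) ¬p = contradiction p ¬p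
indicator-no (no _)  _  = refl

length-filter-map : ∀ {A B : Set} {P : A → Set} (P? : Decidable P) (f : B → A) xs →
                    length (filter P? (map f xs)) ≡ length (filter (P? ∘ f) xs)
length-filter-map P? f [] = refl
length-filter-map P? f (x ∷ xs) with does (P? (f x))
... | true  = cong suc (length-filter-map P? f xs)
... | false = length-filter-map P? f xs

sum-map-0 : ∀ {A : Set} {f : A → ℕ} → (∀ x → f x ≡ 0) → ∀ xs → sum (map f xs) ≡ 0
sum-map-0 f≗0 []       = refl
sum-map-0 f≗0 (x ∷ xs) = cong₂ ℕ._+_ (f≗0 x) (sum-map-0 f≗0 xs)

-- Sums over sublists

module _ {A : Set} where

  ∑sublists : (List A → ℕ) → List A → ℕ
  ∑sublists g []       = g []
  ∑sublists g (x ∷ xs) = ∑sublists g xs ℕ.+ ∑sublists (g ∘ (x ∷_)) xs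

  length-filter-sublists : ∀ {P : List A → Set} (P? : Decidable P) xs →
                           length (filter P? (sublists xs)) ≡ ∑sublists (indicator ∘ P?) xs
  length-filter-sublists P? [] with does (P? [])
  ... | true  = refl
  ... | false = refl
  length-filter-sublists P? (x ∷ xs) = begin
    length (filter P? (sublists xs ++ map (x ∷_) (sublists xs)))
      ≡⟨ cong length (filter-++ P? (sublists xs) _) ⟩
    length (filter P? (sublists xs) ++ filter P? (map (x ∷_) (sublists xs)))
      ≡⟨ length-++ (filter P? (sublists xs)) ⟩
    length (filter P? (sublists xs)) ℕ.+ length (filter P? (map (x ∷_) (sublists xs)))
      ≡⟨ cong₂ ℕ._+_ (length-filter-sublists P? xs)
           (trans (length-filter-map P? (x ∷_) (sublists xs)) (length-filter-sublists (P? ∘ (x ∷_)) xs)) ⟩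
    ∑sublists (indicator ∘ P?) (x ∷ xs) ∎

  ∑sublists-cong : ∀ {g h : List A → ℕ} → g ≗ h → ∀ xs → ∑sublists g xs ≡ ∑sublists h xs
  ∑sublists-cong g≗h []       = g≗h []
  ∑sublists-cong g≗h (x ∷ xs) =
    cong₂ ℕ._+_ (∑sublists-cong g≗h xs) (∑sublists-cong (g≗h ∘ (x ∷_)) xs)

  ∑sublists-0 : ∀ {g : List A → ℕ} → (∀ u → g u ≡ 0) → ∀ xs → ∑sublists g xs ≡ 0
  ∑sublists-0 g≗0 []       = g≗0 []
  ∑sublists-0 g≗0 (x ∷ xs) = cong₂ ℕ._+_ (∑sublists-0 g≗0 xs) (∑sublists-0 (g≗0 ∘ (x ∷_)) xs)

  ∑sublists-+ : ∀ (g h : List A → ℕ) xs →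
                ∑sublists (λ u → g u ℕ.+ h u) xs ≡ ∑sublists g xs ℕ.+ ∑sublists h xs
  ∑sublists-+ g h []       = refl
  ∑sublists-+ g h (x ∷ xs) = trans
    (cong₂ ℕ._+_ (∑sublists-+ g h xs) (∑sublists-+ (g ∘ (x ∷_)) (h ∘ (x ∷_)) xs))
    (ℕ+.interchange (∑sublists g xs) _ _ _)

  -- The outer sum runs over the sublists of `ys`, which will be the chosen blocks containing the
  -- first element: how many there are decides whether the inner sum vanishes.
  ∑sublists-++ : ∀ (g : List A → ℕ) xs ys →
                 ∑sublists g (xs ++ ys) ≡ ∑sublists (λ v → ∑sublists (λ u → g (u ++ v)) xs) ys
  ∑sublists-++ g []       ys = refl
  ∑sublists-++ g (x ∷ xs) ys = trans
    (cong₂ ℕ._+_ (∑sublists-++ g xs ys) (∑sublists-++ (g ∘ (x ∷_)) xs ys))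
    (sym (∑sublists-+ _ _ ys))

  -- For a ground set without the first element: no block may contain that element.
  ∑sublists-[] : ∀ (h : List A → ℕ) → (∀ x v → h (x ∷ v) ≡ 0) → ∀ xs → ∑sublists h xs ≡ h []
  ∑sublists-[] h h∷≡0 []       = refl
  ∑sublists-[] h h∷≡0 (x ∷ xs) = trans
    (cong₂ ℕ._+_ (∑sublists-[] h h∷≡0 xs) (∑sublists-0 (h∷≡0 x) xs))
    (ℕ.+-identityʳ _)

  -- For a ground set with the first element: exactly one block contains it.
  ∑sublists-singletons : ∀ (h : List A → ℕ) → h [] ≡ 0 → (∀ x y v → h (x ∷ y ∷ v) ≡ 0) →
                         ∀ xs → ∑sublists h xs ≡ sum (map (h ∘ [_]) xs)
  ∑sublists-singletons h h[]≡0 h∷∷≡0 []       = h[]≡0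
  ∑sublists-singletons h h[]≡0 h∷∷≡0 (x ∷ xs) = trans
    (cong₂ ℕ._+_ (∑sublists-singletons h h[]≡0 h∷∷≡0 xs) (∑sublists-[] (h ∘ (x ∷_)) (h∷∷≡0 x) xs))
    (ℕ.+-comm _ (h [ x ]))

∑sublists-map : ∀ {A B : Set} (f : A → B) (g : List B → ℕ) xs →
                ∑sublists g (map f xs) ≡ ∑sublists (g ∘ map f) xs
∑sublists-map f g []       = refl
∑sublists-map f g (x ∷ xs) =
  cong₂ ℕ._+_ (∑sublists-map f g xs) (∑sublists-map f (g ∘ (f x ∷_)) xs)

-- Varying the ground set makes recursion possible; IsPartition k is IsPartitionOf ⊤ k by computation.
IsPartitionOf : ∀ {n} → Subset n → ℕ → List (Subset n) → Set
IsPartitionOf U k blocks =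
  length blocks ≡ k × All Nonempty blocks × AllPairs Disjoint blocks × ⋃ blocks ≡ U

isPartitionOf? : ∀ {n} (U : Subset n) k blocks → Dec (IsPartitionOf U k blocks)
isPartitionOf? U k blocks =
  length blocks ℕ.≟ k
    ×-dec All.all? nonempty? blocks
    ×-dec allPairs? (λ p q → ¬? (nonempty? (p ∩ q))) blocks
    ×-dec Vec.≡-dec Bool._≟_ (⋃ blocks) U

-- Partitions with and without the block of the first element

nonempty-outside⁺ : ∀ {n} {p : Subset n} → Nonempty p → Nonempty (outside Vec.∷ p)
nonempty-outside⁺ (x , x∈p) = suc x , Vec.there x∈p

nonempty-outside⁻ : ∀ {n} {p : Subset n} → Nonempty (outside Vec.∷ p) → Nonempty p
nonempty-outside⁻ (suc x , Vec.there x∈p) = x , x∈p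

⋃-++ : ∀ {n} (xs ys : List (Subset n)) → ⋃ (xs ++ ys) ≡ ⋃ xs ∪ ⋃ ys
⋃-++ []       ys = sym (∪-identityˡ _)
⋃-++ (x ∷ xs) ys = trans (cong (x ∪_) (⋃-++ xs ys)) (sym (∪-assoc x (⋃ xs) (⋃ ys)))

⋃-map-outside : ∀ {n} (xs : List (Subset n)) → ⋃ (map (outside Vec.∷_) xs) ≡ outside Vec.∷ ⋃ xs
⋃-map-outside []       = refl
⋃-map-outside (x ∷ xs) = cong ((outside Vec.∷ x) ∪_) (⋃-map-outside xs)

∈⇒⊆⋃ : ∀ {n} {p : Subset n} {xs} → p ∈ˡ xs → p ⊆ ⋃ xs
∈⇒⊆⋃ {xs = _ ∷ xs} (here refl) = p⊆p∪q (⋃ xs)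
∈⇒⊆⋃ {xs = x ∷ xs} (there p∈) x∈p = q⊆p∪q x (⋃ xs) (∈⇒⊆⋃ p∈ x∈p)

-- With its converse `disjoint-⋃⁻`, replaces a condition on each remaining block by one on their
-- union, which will be `U ─ B`.
disjoint-⋃⁺ : ∀ {n} {B : Subset n} {xs} → All (λ p → Disjoint p B) xs → Disjoint (⋃ xs) B
disjoint-⋃⁺ {B = B} [] (x , x∈) = ∉⊥ (proj₁ (x∈p∩q⁻ _ B x∈))
disjoint-⋃⁺ {B = B} {p ∷ xs} (p#B ∷ xs#B) (x , x∈) with x∈p∩q⁻ (⋃ (p ∷ xs)) B x∈
... | x∈⋃ , x∈B with x∈p∪q⁻ p (⋃ xs) x∈⋃
... | inj₁ x∈p  = p#B (x , x∈p∩q⁺ (x∈p , x∈B))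
... | inj₂ x∈xs = disjoint-⋃⁺ xs#B (x , x∈p∩q⁺ (x∈xs , x∈B))

disjoint-⊆ : ∀ {n} {p q B : Subset n} → p ⊆ q → Disjoint q B → Disjoint p B
disjoint-⊆ {p = p} {B = B} p⊆q q#B (x , x∈) with x∈p∩q⁻ p B x∈
... | x∈p , x∈B = q#B (x , x∈p∩q⁺ (p⊆q x∈p , x∈B))

disjoint-⋃⁻ : ∀ {n} {B : Subset n} {xs} → Disjoint (⋃ xs) B → All (λ p → Disjoint p B) xs
disjoint-⋃⁻ ⋃#B = All.tabulate (λ p∈ → disjoint-⊆ (∈⇒⊆⋃ p∈) ⋃#B)

─-∪-cancel : ∀ {n} (U B : Subset n) → B ⊆ U → (U ─ B) ∪ B ≡ U
─-∪-cancel Vec.[]             Vec.[]             B⊆U = refl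
─-∪-cancel (outside Vec.∷ U)  (outside Vec.∷ B)  B⊆U = cong (outside Vec.∷_) (─-∪-cancel U B (drop-∷-⊆ B⊆U))
─-∪-cancel (inside  Vec.∷ U)  (outside Vec.∷ B)  B⊆U = cong (inside Vec.∷_) (─-∪-cancel U B (drop-∷-⊆ B⊆U))
─-∪-cancel (outside Vec.∷ U)  (inside  Vec.∷ B)  B⊆U with () ← B⊆U Vec.here
─-∪-cancel (inside  Vec.∷ U)  (inside  Vec.∷ B)  B⊆U = cong (inside Vec.∷_) (─-∪-cancel U B (drop-∷-⊆ B⊆U))

─-disjoint : ∀ {n} (U B : Subset n) → Disjoint (U ─ B) B
─-disjoint (u       Vec.∷ U) (outside Vec.∷ B) (suc x , Vec.there x∈) = ─-disjoint U B (x , x∈)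
─-disjoint (inside  Vec.∷ U) (outside Vec.∷ B) (zero , ())
─-disjoint (outside Vec.∷ U) (outside Vec.∷ B) (zero , ())
─-disjoint (u       Vec.∷ U) (inside  Vec.∷ B) (suc x , Vec.there x∈) = ─-disjoint U B (x , x∈)

drop-disjoint : ∀ {n} s t {p q : Subset n} → Disjoint (s Vec.∷ p) (t Vec.∷ q) → Disjoint p q
drop-disjoint s t sp#tq (x , x∈) = sp#tq (suc x , Vec.there x∈)

∪-─-cancel : ∀ {n} (p B : Subset n) → Disjoint p B → (p ∪ B) ─ B ≡ p
∪-─-cancel Vec.[]            Vec.[]            p#B = refl
∪-─-cancel (outside Vec.∷ p) (outside Vec.∷ B) p#B = cong (outside Vec.∷_) (∪-─-cancel p B (drop-disjoint outside outside p#B))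
∪-─-cancel (inside  Vec.∷ p) (outside Vec.∷ B) p#B = cong (inside Vec.∷_) (∪-─-cancel p B (drop-disjoint inside outside p#B))
∪-─-cancel (outside Vec.∷ p) (inside  Vec.∷ B) p#B = cong (outside Vec.∷_) (∪-─-cancel p B (drop-disjoint outside inside p#B))
∪-─-cancel (inside  Vec.∷ p) (inside  Vec.∷ B) p#B = contradiction (zero , Vec.here) p#B

disjoint-outsideˡ : ∀ {n} t {p q : Subset n} → Disjoint p q → Disjoint (outside Vec.∷ p) (t Vec.∷ q)
disjoint-outsideˡ t p#q (suc x , Vec.there x∈) = p#q (x , x∈)

outside-isPartition⁺ : ∀ {n} {U : Subset n} {k u} →
  IsPartitionOf U k u → IsPartitionOf (outside Vec.∷ U) k (map (outside Vec.∷_) u)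
outside-isPartition⁺ {u = u} (len , ne , dis , un) =
  trans (length-map _ u) len ,
  All.map⁺ (All.map nonempty-outside⁺ ne) ,
  AllPairs.map⁺ (AllPairs.map (disjoint-outsideˡ outside) dis) ,
  trans (⋃-map-outside u) (cong (outside Vec.∷_) un)

outside-isPartition⁻ : ∀ {n} {U : Subset n} {k u} →
  IsPartitionOf (outside Vec.∷ U) k (map (outside Vec.∷_) u) → IsPartitionOf U k u
outside-isPartition⁻ {u = u} (len , ne , dis , un) =
  trans (sym (length-map _ u)) len ,
  All.map nonempty-outside⁻ (All.map⁻ ne) ,
  AllPairs.map (drop-disjoint outside outside) (AllPairs.map⁻ dis) ,
  Vec.∷-injectiveʳ (trans (sym (⋃-map-outside u)) un)

allPairs-∷ʳ⁻ : ∀ {A : Set} {R : A → A → Set} xs {y} →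
               AllPairs R (xs ++ [ y ]) → AllPairs R xs × All (λ x → R x y) xs
allPairs-∷ʳ⁻ []       _          = [] , []
allPairs-∷ʳ⁻ (x ∷ xs) (Rx ∷ Rxs) with allPairs-∷ʳ⁻ xs Rxs | All.++⁻ xs Rx
... | Rxs′ , Rxsy | Rxxs , (Rxy ∷ []) = Rxxs ∷ Rxs′ , Rxy ∷ Rxsy

module _ {n} (U B : Subset n) (u : List (Subset n)) where

  private
    -- The block of the first element comes last, as in the order of `subsets`.
    blocks : List (Subset (suc n))
    blocks = map (outside Vec.∷_) u ++ [ inside Vec.∷ B ]

    length-blocks : length blocks ≡ suc (length u)
    length-blocks = trans (length-++ (map (outside Vec.∷_) u))
      (trans (ℕ.+-comm _ 1) (cong suc (length-map _ u)))

    ⋃-blocks : ⋃ blocks ≡ inside Vec.∷ (⋃ u ∪ B)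
    ⋃-blocks = trans (⋃-++ (map (outside Vec.∷_) u) _)
      (cong₂ _∪_ (⋃-map-outside u) (cong (inside Vec.∷_) (∪-identityʳ B)))

  inside-isPartition⁺ : ∀ {k} → B ⊆ U → IsPartitionOf (U ─ B) k u → IsPartitionOf (inside Vec.∷ U) (suc k) blocks
  inside-isPartition⁺ B⊆U (len , ne , dis , un) =
    trans length-blocks (cong suc len) ,
    All.++⁺ (All.map⁺ (All.map nonempty-outside⁺ ne)) ((zero , Vec.here) ∷ []) ,
    AllPairs.++⁺ (AllPairs.map⁺ (AllPairs.map (disjoint-outsideˡ outside) dis)) ([] ∷ [])
      (All.map⁺ (All.map (λ p#B → disjoint-outsideˡ inside p#B ∷ [])
        (disjoint-⋃⁻ (subst (λ p → Disjoint p B) (sym un) (─-disjoint U B))))) ,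
    trans ⋃-blocks (cong (inside Vec.∷_) (trans (cong (_∪ B) un) (─-∪-cancel U B B⊆U)))

  -- The tails of the blocks give `⋃ u ∪ B ≡ U`, hence `B ⊆ U`; as `⋃ u` is disjoint from `B`,
  -- removing `B` leaves `⋃ u ≡ U ─ B`.
  inside-isPartition⁻ : ∀ {k} → IsPartitionOf (inside Vec.∷ U) (suc k) blocks → B ⊆ U × IsPartitionOf (U ─ B) k u
  inside-isPartition⁻ (len , ne , dis , un) with allPairs-∷ʳ⁻ (map (outside Vec.∷_) u) dis
  ... | dis₁ , dis₂ =
    subst (B ⊆_) ⋃u∪B≡U (q⊆p∪q (⋃ u) B) ,
    ℕ.suc-injective (trans (sym length-blocks) len) ,
    All.map nonempty-outside⁻ (All.map⁻ (proj₁ (All.++⁻ (map (outside Vec.∷_) u) ne))) ,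
    AllPairs.map (drop-disjoint outside outside) (AllPairs.map⁻ dis₁) ,
    trans (sym (∪-─-cancel (⋃ u) B (disjoint-⋃⁺ (All.map (drop-disjoint outside inside) (All.map⁻ dis₂))))) (cong (_─ B) ⋃u∪B≡U)
    where
    ⋃u∪B≡U : ⋃ u ∪ B ≡ U
    ⋃u∪B≡U = Vec.∷-injectiveʳ (trans (sym ⋃-blocks) un)

-- Choosing a subset B of U amounts to choosing the size of U ─ B and then its elements.
∑-⊆ : ∀ {n} (f : ℕ → ℕ) (U : Subset n) →
      sum (map (λ B → if does (B ⊆? U) then f ∣ U ─ B ∣ else 0) (subsets n)) ≡ (const 1 ⊛ f) ∣ U ∣
∑-⊆ f Vec.[] = refl
∑-⊆ {suc n} f (s Vec.∷ U) = begin
  sum (map weight (map (outside Vec.∷_) (subsets n) ++ map (inside Vec.∷_) (subsets n)))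
    ≡⟨ cong sum (map-++ weight (map (outside Vec.∷_) (subsets n)) _) ⟩
  sum (map weight (map (outside Vec.∷_) (subsets n)) ++ map weight (map (inside Vec.∷_) (subsets n)))
    ≡⟨ sum-++ (map weight (map (outside Vec.∷_) (subsets n))) _ ⟩
  sum (map weight (map (outside Vec.∷_) (subsets n))) ℕ.+ sum (map weight (map (inside Vec.∷_) (subsets n)))
    ≡⟨ cong₂ (λ xs ys → sum xs ℕ.+ sum ys) (sym (map-∘ (subsets n))) (sym (map-∘ (subsets n))) ⟩
  sum (map (weight ∘ (outside Vec.∷_)) (subsets n)) ℕ.+ sum (map (weight ∘ (inside Vec.∷_)) (subsets n))
    ≡⟨ split s ⟩
  (const 1 ⊛ f) ∣ s Vec.∷ U ∣ ∎
  where
  weight : Subset (suc n) → ℕ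
  weight B = if does (B ⊆? (s Vec.∷ U)) then f ∣ (s Vec.∷ U) ─ B ∣ else 0

  split : ∀ s → let w = λ B → if does (B ⊆? (s Vec.∷ U)) then f ∣ (s Vec.∷ U) ─ B ∣ else 0 in
    sum (map (w ∘ (outside Vec.∷_)) (subsets n)) ℕ.+ sum (map (w ∘ (inside Vec.∷_)) (subsets n))
      ≡ (const 1 ⊛ f) ∣ s Vec.∷ U ∣
  split outside = trans (cong₂ ℕ._+_ (∑-⊆ f U) (sum-map-0 (λ _ → refl) (subsets n))) (ℕ.+-identityʳ _)
  -- A `B` without the first element leaves it in the complement, whence `f ∘ suc`; the two cases
  -- are the two Leibniz terms.
  split inside  = trans (cong₂ ℕ._+_ (∑-⊆ (f ∘ suc) U) (∑-⊆ f U)) (ℕ.+-comm _ ((const 1 ⊛ f) ∣ U ∣))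

-- A sublist splits into blocks `u` avoiding the first element and blocks `v` containing it. If the
-- ground set lacks that element, `v` is empty; otherwise `v` is one block with tail `B` and `u`
-- partitions `U ─ B`, so that `∑-⊆` sums over the choices of `B`.
∑-isPartitionOf : ∀ {n} (U : Subset n) k →
                  ∑sublists (indicator ∘ isPartitionOf? U k) (subsets n) ≡ blockCount k ∣ U ∣
∑-isPartitionOf Vec.[] zero    = refl
∑-isPartitionOf Vec.[] (suc k) =
  -- Over no elements the only candidate block is empty, which the nonemptiness condition excludes.
  cong (0 ℕ.+_) (indicator-no (isPartitionOf? Vec.[] (suc k) [ Vec.[] ]) λ { (_ , (() , _) ∷ _ , _) })
∑-isPartitionOf {suc n} (s Vec.∷ U) k = begin
  ∑sublists count (map (outside Vec.∷_) (subsets n) ++ map (inside Vec.∷_) (subsets n))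
    ≡⟨ ∑sublists-++ count (map (outside Vec.∷_) (subsets n)) _ ⟩
  ∑sublists (λ v → ∑sublists (λ u → count (u ++ v)) (map (outside Vec.∷_) (subsets n))) (map (inside Vec.∷_) (subsets n))
    ≡⟨ ∑sublists-map (inside Vec.∷_) _ (subsets n) ⟩
  ∑sublists (λ v → ∑sublists (λ u → count (u ++ map (inside Vec.∷_) v)) (map (outside Vec.∷_) (subsets n))) (subsets n)
    ≡⟨ ∑sublists-cong (λ v → ∑sublists-map (outside Vec.∷_) _ (subsets n)) (subsets n) ⟩
  ∑sublists (extensions s k) (subsets n)
    ≡⟨ by-first-element s k ⟩
  blockCount k ∣ s Vec.∷ U ∣ ∎
  where
  count : List (Subset (suc n)) → ℕ
  count = indicator ∘ isPartitionOf? (s Vec.∷ U) k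

  extensions : ∀ s k → List (Subset n) → ℕ
  extensions s k v = ∑sublists
    (λ u → indicator (isPartitionOf? (s Vec.∷ U) k (map (outside Vec.∷_) u ++ map (inside Vec.∷_) v)))
    (subsets n)

  extensions-0 : ∀ s k v → (∀ u → ¬ IsPartitionOf (s Vec.∷ U) k (map (outside Vec.∷_) u ++ map (inside Vec.∷_) v)) →
                 extensions s k v ≡ 0
  extensions-0 s k v ¬part = ∑sublists-0 (λ u → indicator-no (isPartitionOf? _ _ _) (¬part u)) (subsets n)

  extensions-singleton : ∀ k B → extensions inside (suc k) [ B ] ≡ (if does (B ⊆? U) then blockCount k ∣ U ─ B ∣ else 0)
  extensions-singleton k B with B ⊆? U
  ... | yes B⊆U = trans
    (∑sublists-cong (λ u → indicator-cong (isPartitionOf? _ _ _) (isPartitionOf? (U ─ B) k u)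
      (proj₂ ∘ inside-isPartition⁻ U B u) (inside-isPartition⁺ U B u B⊆U)) (subsets n))
    -- `U ─ B` is not a subterm of the ground set; the recursion descends on the length `n`.
    (∑-isPartitionOf (U ─ B) k)
  ... | no B⊈U = extensions-0 inside (suc k) [ B ] (λ u part → B⊈U (proj₁ (inside-isPartition⁻ U B u part)))

  by-first-element : ∀ s k → ∑sublists (extensions s k) (subsets n) ≡ blockCount k ∣ s Vec.∷ U ∣
  by-first-element outside k = begin
    ∑sublists (extensions outside k) (subsets n)
      ≡⟨ ∑sublists-[] (extensions outside k) (λ B v → extensions-0 outside k (B ∷ v) (no-block B v)) (subsets n) ⟩
    extensions outside k []
      ≡⟨ ∑sublists-cong (λ u → indicator-cong (isPartitionOf? _ _ _) (isPartitionOf? U k u)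
           (outside-isPartition⁻ ∘ subst (IsPartitionOf _ k) (++-identityʳ _))
           (subst (IsPartitionOf _ k) (sym (++-identityʳ _)) ∘ outside-isPartition⁺)) (subsets n) ⟩
    ∑sublists (indicator ∘ isPartitionOf? U k) (subsets n)
      ≡⟨ ∑-isPartitionOf U k ⟩
    blockCount k ∣ U ∣ ∎
    where
    no-block : ∀ B v u → ¬ IsPartitionOf (outside Vec.∷ U) k (map (outside Vec.∷_) u ++ map (inside Vec.∷_) (B ∷ v))
    no-block B v u (_ , _ , _ , un)
      with () ← subst (zero ∈_) un (∈⇒⊆⋃ {p = inside Vec.∷ B} (∈-++⁺ʳ (map (outside Vec.∷_) u) (here refl)) Vec.here)
  by-first-element inside k = begin
    ∑sublists (extensions inside k) (subsets n)
      ≡⟨ ∑sublists-singletons (extensions inside k) (extensions-0 inside k [] no-block)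
           (λ B C v → extensions-0 inside k (B ∷ C ∷ v) (two-blocks B C v)) (subsets n) ⟩
    sum (map (extensions inside k ∘ [_]) (subsets n))
      ≡⟨ one-block k ⟩
    blockCount k (suc ∣ U ∣) ∎
    where
    no-block : ∀ u → ¬ IsPartitionOf (inside Vec.∷ U) k (map (outside Vec.∷_) u ++ [])
    no-block u (_ , _ , _ , un)
      with () ← trans (sym (⋃-map-outside u)) (trans (cong ⋃ (sym (++-identityʳ (map (outside Vec.∷_) u)))) un)

    two-blocks : ∀ B C v u → ¬ IsPartitionOf (inside Vec.∷ U) k
                   (map (outside Vec.∷_) u ++ map (inside Vec.∷_) (B ∷ C ∷ v))
    two-blocks B C v u (_ , _ , dis , _) = meet u dis
      where
      -- Two blocks from the second half share the element `zero`; the recursion only strips the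
      -- blocks `u` in front of them.
      meet : ∀ u → ¬ AllPairs Disjoint (map (outside Vec.∷_) u ++ map (inside Vec.∷_) (B ∷ C ∷ v))
      meet []      ((B#C ∷ _) ∷ _) = B#C (zero , Vec.here)
      meet (_ ∷ u) (_ ∷ dis)       = meet u dis

    one-block : ∀ k → sum (map (extensions inside k ∘ [_]) (subsets n)) ≡ blockCount k (suc ∣ U ∣)
    one-block zero    = sum-map-0
      (λ B → extensions-0 inside zero [ B ] λ { [] (() , _) ; (_ ∷ _) (() , _) }) (subsets n)
    one-block (suc k) = trans (cong sum (map-cong (extensions-singleton k) (subsets n))) (∑-⊆ (blockCount k) U)

stirling₂≡blockCount : ∀ n k → stirling₂ n k ≡ blockCount k n
stirling₂≡blockCount n k = begin
  stirling₂ n k                                              ≡⟨ length-filter-sublists (isPartition? k) (subsets n) ⟩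
  ∑sublists (indicator ∘ isPartitionOf? ⊤ k) (subsets n)     ≡⟨ ∑-isPartitionOf (⊤ {n}) k ⟩
  blockCount k ∣ ⊤ {n} ∣                                     ≡⟨ cong (blockCount k) (∣⊤∣≡n n) ⟩
  blockCount k n                                             ∎

-- α * α computes to α + 1#, and likewise for β.
binet : ∀ m → α ^ m + β ^ m ≡ ι (lucas m)
binet 0 = refl
binet 1 = refl
binet (suc (suc m)) = begin
  α * (α * α ^ m) + β * (β * β ^ m)
    ≡⟨ cong₂ _+_ (ℚ√5.*-assoc α α (α ^ m)) (ℚ√5.*-assoc β β (β ^ m)) ⟨
  (α + 1#) * α ^ m + (β + 1#) * β ^ m
    ≡⟨ solve 4 (λ a b x y → (a :+ con 1) :* x :+ (b :+ con 1) :* y := (a :* x :+ b :* y) :+ (x :+ y))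
         refl α β (α ^ m) (β ^ m) ⟩
  (α ^ suc m + β ^ suc m) + (α ^ m + β ^ m)
    ≡⟨ cong₂ _+_ (binet (suc m)) (binet m) ⟩
  ι (lucas (suc m)) + ι (lucas m)
    ≡⟨ ι-+ (lucas (suc m)) (lucas m) ⟨
  ι (lucas (suc (suc m))) ∎

theorem4 : egf lucasFubini ≈ (α · exp (α · (eᵗ -ˢ 1ˢ)) refl) +ˢ (β · exp (β · (eᵗ -ˢ 1ˢ)) refl)
theorem4 n = begin
  egf lucasFubini n
    ≡⟨ egf≡ι*eᵗ lucasFubini n ⟩
  ι (lucasFubini n) * eᵗ n
    ≡⟨ cong (_* eᵗ n) (ι-sum (λ k → lucas (suc k) ℕ.* stirling₂ n k) n) ⟩
  ∑≤ n (λ k → ι (lucas (suc k) ℕ.* stirling₂ n k)) * eᵗ n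
    ≡⟨ ℚ√5.*-comm _ (eᵗ n) ⟩
  eᵗ n * ∑≤ n (λ k → ι (lucas (suc k) ℕ.* stirling₂ n k))
    ≡⟨ ∑≤-*ˡ (eᵗ n) (λ k → ι (lucas (suc k) ℕ.* stirling₂ n k)) n ⟨
  ∑≤ n (λ k → eᵗ n * ι (lucas (suc k) ℕ.* stirling₂ n k))
    ≡⟨ ∑≤-cong n term ⟩
  ∑≤ n (λ k → α ^ suc k * egf (blockCount k) n + β ^ suc k * egf (blockCount k) n)
    ≡⟨ ∑≤-+ (λ k → α ^ suc k * egf (blockCount k) n) (λ k → β ^ suc k * egf (blockCount k) n) n ⟩
  ∑≤ n (λ k → α ^ suc k * egf (blockCount k) n) + ∑≤ n (λ k → β ^ suc k * egf (blockCount k) n)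
    -- The vanishing of the constant term is an irrelevant argument of `exp`, so `refl` here agrees
    -- with `ℚ√5.zeroʳ c` in the lemma.
    ≡⟨ cong₂ _+_ (c·exp[c·[eᵗ-1]] α n) (c·exp[c·[eᵗ-1]] β n) ⟨
  ((α · exp (α · (eᵗ -ˢ 1ˢ)) refl) +ˢ (β · exp (β · (eᵗ -ˢ 1ˢ)) refl)) n ∎
  where
  term : ∀ k → eᵗ n * ι (lucas (suc k) ℕ.* stirling₂ n k) ≡
               α ^ suc k * egf (blockCount k) n + β ^ suc k * egf (blockCount k) n
  term k = begin
    eᵗ n * ι (lucas (suc k) ℕ.* stirling₂ n k)
      ≡⟨ cong (λ s → eᵗ n * ι (lucas (suc k) ℕ.* s)) (stirling₂≡blockCount n k) ⟩
    eᵗ n * ι (lucas (suc k) ℕ.* blockCount k n)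
      ≡⟨ cong (eᵗ n *_) (ι-* (lucas (suc k)) (blockCount k n)) ⟩
    eᵗ n * (ι (lucas (suc k)) * ι (blockCount k n))
      ≡⟨ solve 3 (λ x y z → x :* (y :* z) := y :* (z :* x)) refl (eᵗ n) (ι (lucas (suc k))) (ι (blockCount k n)) ⟩
    ι (lucas (suc k)) * (ι (blockCount k n) * eᵗ n)
      ≡⟨ cong₂ _*_ (sym (binet (suc k))) (sym (egf≡ι*eᵗ (blockCount k) n)) ⟩
    (α ^ suc k + β ^ suc k) * egf (blockCount k) n
      ≡⟨ ℚ√5.distribʳ _ (α ^ suc k) (β ^ suc k) ⟩
    α ^ suc k * egf (blockCount k) n + β ^ suc k * egf (blockCount k) n ∎
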